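{- Let $\alpha$ and $\beta$ be finite sequences of positive integers, each with an even number of elements, and let $a=\breve K(\alpha)$, $b=\breve K(\alpha\beta)$ and $c=\breve K(\beta)$. Then $$\tilde\Sigma\Big((\alpha,a),(\alpha\beta,b),(\beta,c)\Big)=\frac{\breve K(\alpha^2)}{\breve K(\alpha)}\,b-c .$$
   Context: Concatenation of finite sequences $\alpha,\beta$ is written $\alpha\beta$ or $\alpha\oplus\beta$; $\alpha^2=\alpha\alpha$. Continuants: $K_0()=1$, $K_1(x_1)=x_1$, $K_n(x_1,\ldots,x_n)=x_nK_{n-1}(x_1,\ldots,x_{n-1})+K_{n-2}(x_1,\ldots,x_{n-2})$. For $\alpha=(a_1,\ldots,a_n)$ put $K(\alpha)=K_n(a_1,\ldots,a_n)$ and $\breve K(\alpha)=K_{n-1}(a_1,\ldots,a_{n-1})$. The operation $\tilde\Sigma$ is defined on triples of pairs (sequence, integer) by $$\tilde\Sigma\big((\alpha_1,a_1),(\alpha_2,a_2),(\alpha_3,a_3)\big)=\breve K(\alpha_1\oplus\alpha_2),$$ so that the left-hand side of the claim is $\breve K(\alpha\oplus\alpha\beta)=\breve K(\alpha^2\beta)$. -}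

module Defs where

open import Data.Integer.Base as ℤ using (ℤ)
open import Data.List.Base using (List; []; _∷_; _++_; reverse)
open import Data.List.Properties using (reverse-involutive)
open import Data.List.Relation.Binary.Permutation.Propositional using (↭-sym)
open import Data.List.Relation.Binary.Permutation.Propositional.Properties
  using (All-resp-↭; ↭-reverse)
open import Data.List.Relation.Unary.All using (All; []; _∷_)
open import Data.Nat.Base using (ℕ; suc; _+_; _*_; NonZero)
open import Data.Nat.Properties using (m*n≢0)
open import Data.Product.Base using (_×_; _,_)
open import Relation.Binary.PropositionalEquality using (_≡_; _≢_; refl; sym; trans; cong)
open import Relation.Nullary using (contradiction)

-- The recurrence for continuants removes the last entry of a sequence, so it
-- is written on reversed lists: Kʳ (xₙ ∷ … ∷ x₁ ∷ []) = Kₙ(x₁,…,xₙ).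
Kʳ : List ℕ → ℕ
Kʳ []           = 1
Kʳ (x ∷ [])     = x
Kʳ (x ∷ y ∷ xs) = x * Kʳ (y ∷ xs) + Kʳ xs

-- K̆ʳ (xₙ ∷ … ∷ x₁ ∷ []) = Kₙ₋₁(x₁,…,xₙ₋₁).  For the empty sequence this is
-- K₋₁ = 0, the value forced by extending the recurrence to K₁(x) = x K₀() + K₋₁.
K̆ʳ : List ℕ → ℕ
K̆ʳ []       = 0
K̆ʳ (_ ∷ xs) = Kʳ xs

K : List ℕ → ℕ
K α = Kʳ (reverse α)

K̆ : List ℕ → ℕ
K̆ α = K̆ʳ (reverse α)

-- The integer components do not enter the value.
Σ̃ : (List ℕ × ℤ) × (List ℕ × ℤ) × (List ℕ × ℤ) → ℤ
Σ̃ ((α₁ , _) , (α₂ , _) , _) = ℤ.+ K̆ (α₁ ++ α₂)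

+-nonZeroˡ : ∀ m n → NonZero m → NonZero (m + n)
+-nonZeroˡ (suc _) _ _ = _

Kʳ-nonZero : ∀ {xs} → All NonZero xs → NonZero (Kʳ xs)
Kʳ-nonZero []                                = _
Kʳ-nonZero (px ∷ [])                         = px
Kʳ-nonZero {x ∷ y ∷ xs} (px ∷ pxs@(_ ∷ _)) =
  +-nonZeroˡ (x * Kʳ (y ∷ xs)) (Kʳ xs)
    (m*n≢0 x (Kʳ (y ∷ xs)) {{px}} {{Kʳ-nonZero pxs}})

K̆ʳ-nonZero : ∀ {xs} → All NonZero xs → xs ≢ [] → NonZero (K̆ʳ xs)
K̆ʳ-nonZero []        ne = contradiction refl ne
K̆ʳ-nonZero (_ ∷ pxs) _  = Kʳ-nonZero pxs

K̆-nonZero : ∀ {α} → All NonZero α → α ≢ [] → NonZero (K̆ α)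
K̆-nonZero {α} pos ne =
  K̆ʳ-nonZero (All-resp-↭ (↭-sym (↭-reverse α)) pos)
    (λ eq → ne (trans (sym (reverse-involutive α)) (cong reverse eq)))

{-# OPTIONS --safe #-}
-- Appending an entry x to a sequence acts on the column (K, K̆) by the matrix
-- [[x,1],[1,0]] of determinant −1.  For α of even length the product A of these
-- matrices has determinant 1, so A² + I = tr(A) A by Cayley–Hamilton.  Applying
-- this to the column (1,0), followed by the matrix of β, gives
-- K̆(α²β) + K̆(β) = tr(A) K̆(αβ); the case of empty β identifies tr(A) with
-- K̆(α²)/K̆(α).
module Submission where

open import Defs
open import Data.Integer.Base as ℤ using (ℤ)
import Data.Integer.Properties as ℤ
open import Data.Integer.Tactic.RingSolver using () renaming (solve-∀ to ℤ-solve-∀)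
open import Data.List.Base using (List; []; _∷_; _++_; length; reverse; foldr)
open import Data.List.Properties using (++-identityʳ; foldr-++; reverse-++; length-reverse)
open import Data.List.Relation.Unary.All using (All)
open import Data.Nat.Base as ℕ using (ℕ; suc; NonZero)
open import Data.Nat.Divisibility using (_∣_; ∣m+n∣m⇒∣n; ∣-refl; ∣1⇒≡1)
import Data.Nat.Properties as ℕ
open import Data.Nat.Tactic.RingSolver using (solve-∀)
open import Data.Product.Base using (_×_; _,_; proj₁; proj₂)
open import Data.Rational.Base using (_/_; _*_; _-_; -_; toℚᵘ)
open import Data.Rational.Properties
  using (toℚᵘ-injective; toℚᵘ-fromℚᵘ; toℚᵘ-homo-+; toℚᵘ-homo-*; toℚᵘ-homo‿-; fromℚᵘ-cong)
open import Data.Rational.Unnormalised.Base as ℚᵘ using (mkℚᵘ; *≡*)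
import Data.Rational.Unnormalised.Properties as ℚᵘ
open import Relation.Binary.PropositionalEquality
  using (_≡_; _≢_; refl; sym; trans; cong; cong₂; subst; module ≡-Reasoning)

step : ℕ → ℕ × ℕ → ℕ × ℕ
step x (p , q) = x ℕ.* p ℕ.+ q , p

act : List ℕ → ℕ × ℕ → ℕ × ℕ
act xs v = foldr step v xs

e₁ e₂ : ℕ × ℕ
e₁ = 1 , 0
e₂ = 0 , 1

Kʳ-∷ : ∀ x xs → Kʳ (x ∷ xs) ≡ x ℕ.* Kʳ xs ℕ.+ K̆ʳ xs
Kʳ-∷ x []      = sym (trans (ℕ.+-identityʳ (x ℕ.* 1)) (ℕ.*-identityʳ x))
Kʳ-∷ x (_ ∷ _) = refl

-- The column `e₁` is the pair (K₀, K₋₁) of the empty sequence, and each `step` is one use of the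
-- recurrence.
act-e₁ : ∀ xs → act xs e₁ ≡ (Kʳ xs , K̆ʳ xs)
act-e₁ []       = refl
act-e₁ (x ∷ xs) = trans (cong (step x) (act-e₁ xs)) (cong (_, Kʳ xs) (sym (Kʳ-∷ x xs)))

combine : ℕ × ℕ → ℕ × ℕ → ℕ × ℕ → ℕ × ℕ
combine (p , q) (a , b) (c , d) = p ℕ.* a ℕ.+ q ℕ.* c , p ℕ.* b ℕ.+ q ℕ.* d

step-combine : ∀ x w u v → step x (combine w u v) ≡ combine w (step x u) (step x v)
step-combine x (p , q) (a , b) (c , d) = cong (_, p ℕ.* a ℕ.+ q ℕ.* c) (lemma x p q a b c d)
  where
  lemma : ∀ x p q a b c d →
    x ℕ.* (p ℕ.* a ℕ.+ q ℕ.* c) ℕ.+ (p ℕ.* b ℕ.+ q ℕ.* d)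
      ≡ p ℕ.* (x ℕ.* a ℕ.+ b) ℕ.+ q ℕ.* (x ℕ.* c ℕ.+ d)
  lemma = solve-∀

act-combine : ∀ xs w u v → act xs (combine w u v) ≡ combine w (act xs u) (act xs v)
act-combine []       w u v = refl
act-combine (x ∷ xs) w u v =
  trans (cong (step x) (act-combine xs w u v)) (step-combine x w (act xs u) (act xs v))

-- A matrix is determined by its columns, here `act xs e₁` and `act xs e₂`. Taking `w = act xs e₁`
-- expresses A²e₁ through the entries of A.
act-linear : ∀ xs w → act xs w ≡ combine w (act xs e₁) (act xs e₂)
act-linear xs w@(p , q) =
  trans (cong (act xs) (cong₂ _,_ (lemma₁ p q) (lemma₂ p q))) (act-combine xs w e₁ e₂)
  where
  lemma₁ : ∀ p q → p ≡ p ℕ.* 1 ℕ.+ q ℕ.* 0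
  lemma₁ = solve-∀
  lemma₂ : ∀ p q → q ≡ p ℕ.* 0 ℕ.+ q ℕ.* 1
  lemma₂ = solve-∀

-- Determinant 1 for the matrix with these two columns, arranged so that no subtraction occurs in ℕ.
Unimodular : ℕ × ℕ → ℕ × ℕ → Set
Unimodular (p , q) (r , s) = p ℕ.* s ≡ q ℕ.* r ℕ.+ 1

-- The columns trade places because a single step has determinant −1.
step-unimodular : ∀ x u v → Unimodular u v → Unimodular (step x v) (step x u)
step-unimodular x (p , q) (r , s) det = begin
  (x ℕ.* r ℕ.+ s) ℕ.* p              ≡⟨ expand x p r s ⟩
  x ℕ.* r ℕ.* p ℕ.+ p ℕ.* s          ≡⟨ cong (x ℕ.* r ℕ.* p ℕ.+_) det ⟩
  x ℕ.* r ℕ.* p ℕ.+ (q ℕ.* r ℕ.+ 1)  ≡⟨ collect x p q r ⟩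
  r ℕ.* (x ℕ.* p ℕ.+ q) ℕ.+ 1        ∎
  where
  open ≡-Reasoning
  expand : ∀ x p r s → (x ℕ.* r ℕ.+ s) ℕ.* p ≡ x ℕ.* r ℕ.* p ℕ.+ p ℕ.* s
  expand = solve-∀
  collect : ∀ x p q r →
    x ℕ.* r ℕ.* p ℕ.+ (q ℕ.* r ℕ.+ 1) ≡ r ℕ.* (x ℕ.* p ℕ.+ q) ℕ.+ 1
  collect = solve-∀

act-unimodular : ∀ xs → 2 ∣ length xs → Unimodular (act xs e₁) (act xs e₂)
act-unimodular []           _    = refl
act-unimodular (_ ∷ [])     even with () ← ∣1⇒≡1 even
act-unimodular (x ∷ y ∷ xs) even =
  -- Entries are consumed in pairs: the second exchange of columns undoes the first.
  step-unimodular x (act (y ∷ xs) e₂) (act (y ∷ xs) e₁)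
    (step-unimodular y (act xs e₁) (act xs e₂)
      (act-unimodular xs (∣m+n∣m⇒∣n even ∣-refl)))

trace : List ℕ → ℕ
trace xs = proj₁ (act xs e₁) ℕ.+ proj₂ (act xs e₂)

-- The identity A² + I = tr(A) A is applied to `e₁`, the column that yields continuants. Both sides
-- are `combine` terms, the right one padded with coefficient 0, so that `act-combine` can carry a
-- further matrix through them.
cayley-hamilton : ∀ xs → 2 ∣ length xs →
  combine (1 , 1) (act xs (act xs e₁)) e₁ ≡ combine (trace xs , 0) (act xs e₁) e₁
cayley-hamilton xs even =
  trans (cong (λ w → combine (1 , 1) w e₁) (act-linear xs (act xs e₁)))
        (lemma (act xs e₁) (act xs e₂) (act-unimodular xs even))
  where
  lemma : ∀ u v → Unimodular u v →
    combine (1 , 1) (combine u u v) e₁ ≡ combine (proj₁ u ℕ.+ proj₂ v , 0) u e₁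
  lemma (p , q) (r , s) det = cong₂ _,_ first (second p q s)
    where
    expand : ∀ p q r → 1 ℕ.* (p ℕ.* p ℕ.+ q ℕ.* r) ℕ.+ 1 ≡ p ℕ.* p ℕ.+ (q ℕ.* r ℕ.+ 1)
    expand = solve-∀
    collect : ∀ p s → p ℕ.* p ℕ.+ p ℕ.* s ≡ (p ℕ.+ s) ℕ.* p ℕ.+ 0
    collect = solve-∀
    -- The added 1 comes from `e₁` and turns qr into ps by the determinant; the second coordinate is
    -- a plain ring identity.
    first : 1 ℕ.* (p ℕ.* p ℕ.+ q ℕ.* r) ℕ.+ 1 ≡ (p ℕ.+ s) ℕ.* p ℕ.+ 0
    first = trans (expand p q r) (trans (cong (p ℕ.* p ℕ.+_) (sym det)) (collect p s))
    second : ∀ p q s → 1 ℕ.* (p ℕ.* q ℕ.+ q ℕ.* s) ℕ.+ 0 ≡ (p ℕ.+ s) ℕ.* q ℕ.+ 0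
    second = solve-∀

K̆-act : ∀ α → K̆ α ≡ proj₂ (act (reverse α) e₁)
K̆-act α = cong proj₂ (sym (act-e₁ (reverse α)))

-- `foldr` applies the head last, so after reversal the matrix of `α` acts first.
act-reverse-++ : ∀ α β v → act (reverse (α ++ β)) v ≡ act (reverse β) (act (reverse α) v)
act-reverse-++ α β v =
  trans (cong (λ xs → act xs v) (reverse-++ α β)) (foldr-++ step v (reverse β) (reverse α))

K̆-++ : ∀ α β → K̆ (α ++ β) ≡ proj₂ (act (reverse β) (act (reverse α) e₁))
K̆-++ α β = trans (K̆-act (α ++ β)) (cong proj₂ (act-reverse-++ α β e₁))

K̆-recurrence : ∀ α β → 2 ∣ length α →
  K̆ (α ++ α ++ β) ℕ.+ K̆ β ≡ trace (reverse α) ℕ.* K̆ (α ++ β)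
K̆-recurrence α β even = begin
  K̆ (α ++ α ++ β) ℕ.+ K̆ β
    ≡⟨ cong₂ ℕ._+_ (trans (K̆-++ α (α ++ β)) (cong proj₂ (act-reverse-++ α β (A e₁)))) (K̆-act β) ⟩
  proj₂ (B (A (A e₁))) ℕ.+ proj₂ (B e₁)
    ≡⟨ cong₂ ℕ._+_ (ℕ.*-identityˡ (proj₂ (B (A (A e₁))))) (ℕ.*-identityˡ (proj₂ (B e₁))) ⟨
  proj₂ (combine (1 , 1) (B (A (A e₁))) (B e₁))
    ≡⟨ cong proj₂ (act-combine (reverse β) (1 , 1) (A (A e₁)) e₁) ⟨
  proj₂ (B (combine (1 , 1) (A (A e₁)) e₁))
    ≡⟨ cong (λ v → proj₂ (B v)) (cayley-hamilton (reverse α) even′) ⟩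
  proj₂ (B (combine (t , 0) (A e₁) e₁))
    ≡⟨ cong proj₂ (act-combine (reverse β) (t , 0) (A e₁) e₁) ⟩
  t ℕ.* proj₂ (B (A e₁)) ℕ.+ 0
    ≡⟨ ℕ.+-identityʳ _ ⟩
  t ℕ.* proj₂ (B (A e₁))
    ≡⟨ cong (t ℕ.*_) (K̆-++ α β) ⟨
  t ℕ.* K̆ (α ++ β) ∎
  where
  open ≡-Reasoning
  t = trace (reverse α)
  A B : ℕ × ℕ → ℕ × ℕ
  A = act (reverse α)
  B = act (reverse β)
  even′ : 2 ∣ length (reverse α)
  even′ = subst (2 ∣_) (sym (length-reverse α)) even

K̆-square : ∀ α → 2 ∣ length α → K̆ (α ++ α) ≡ trace (reverse α) ℕ.* K̆ α
K̆-square α even = begin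
  K̆ (α ++ α)                       ≡⟨ cong (λ γ → K̆ (α ++ γ)) (++-identityʳ α) ⟨
  -- The convention K₋₁ = 0 makes `K̆ []` vanish.
  K̆ (α ++ α ++ [])                 ≡⟨ ℕ.+-identityʳ _ ⟨
  K̆ (α ++ α ++ []) ℕ.+ K̆ []        ≡⟨ K̆-recurrence α [] even ⟩
  trace (reverse α) ℕ.* K̆ (α ++ [])  ≡⟨ cong (λ γ → trace (reverse α) ℕ.* K̆ γ) (++-identityʳ α) ⟩
  trace (reverse α) ℕ.* K̆ α        ∎
  where
  open ≡-Reasoning

m*n/n≡m/1 : ∀ m n .{{_ : NonZero n}} → (ℤ.+ (m ℕ.* n)) / n ≡ ℤ.+ m / 1
m*n/n≡m/1 m n@(suc n-1) = fromℚᵘ-cong {mkℚᵘ (ℤ.+ (m ℕ.* n)) n-1} {mkℚᵘ (ℤ.+ m) 0}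
  (*≡* (trans (ℤ.*-identityʳ _) (ℤ.pos-* m n)))

-- Unnormalised rationals need no reduction by a gcd, so there the claim is a cross-multiplied
-- identity of integers.
/1-*-minus : ∀ i j k → (i ℤ.* j ℤ.- k) / 1 ≡ i / 1 * (j / 1) - k / 1
/1-*-minus i j k = toℚᵘ-injective (begin
  toℚᵘ ((i ℤ.* j ℤ.- k) / 1)                       ≈⟨ toℚᵘ-/1 (i ℤ.* j ℤ.- k) ⟩
  mkℚᵘ (i ℤ.* j ℤ.- k) 0                            ≈⟨ *≡* (lemma i j k) ⟩
  mkℚᵘ i 0 ℚᵘ.* mkℚᵘ j 0 ℚᵘ.- mkℚᵘ k 0
    ≈⟨ ℚᵘ.+-cong (ℚᵘ.*-cong (toℚᵘ-/1 i) (toℚᵘ-/1 j)) (ℚᵘ.-‿cong (toℚᵘ-/1 k)) ⟨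
  toℚᵘ (i / 1) ℚᵘ.* toℚᵘ (j / 1) ℚᵘ.- toℚᵘ (k / 1)
    ≈⟨ ℚᵘ.+-cong (toℚᵘ-homo-* (i / 1) (j / 1)) (toℚᵘ-homo‿- (k / 1)) ⟨
  toℚᵘ (i / 1 * (j / 1)) ℚᵘ.+ toℚᵘ (- (k / 1))     ≈⟨ toℚᵘ-homo-+ (i / 1 * (j / 1)) (- (k / 1)) ⟨
  toℚᵘ (i / 1 * (j / 1) - k / 1)                    ∎)
  where
  open ℚᵘ.≃-Reasoning
  toℚᵘ-/1 : ∀ i → toℚᵘ (i / 1) ℚᵘ.≃ mkℚᵘ i 0
  toℚᵘ-/1 i = toℚᵘ-fromℚᵘ (mkℚᵘ i 0)
  lemma : ∀ i j k → (i ℤ.* j ℤ.- k) ℤ.* ℤ.1ℤ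
    ≡ (i ℤ.* j ℤ.* ℤ.1ℤ ℤ.+ (ℤ.- k) ℤ.* ℤ.1ℤ) ℤ.* ℤ.1ℤ
  lemma = ℤ-solve-∀

pos-minus : ∀ s c t b → s ℕ.+ c ≡ t ℕ.* b → ℤ.+ s ≡ ℤ.+ t ℤ.* ℤ.+ b ℤ.- ℤ.+ c
pos-minus s c t b eq = begin
  ℤ.+ s                          ≡⟨ lemma (ℤ.+ s) (ℤ.+ c) ⟩
  ℤ.+ (s ℕ.+ c) ℤ.- ℤ.+ c        ≡⟨ cong (λ n → ℤ.+ n ℤ.- ℤ.+ c) eq ⟩
  ℤ.+ (t ℕ.* b) ℤ.- ℤ.+ c        ≡⟨ cong (ℤ._- ℤ.+ c) (ℤ.pos-* t b) ⟩
  ℤ.+ t ℤ.* ℤ.+ b ℤ.- ℤ.+ c      ∎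
  where
  open ≡-Reasoning
  lemma : ∀ i j → i ≡ i ℤ.+ j ℤ.- j
  lemma = ℤ-solve-∀

corollary7p19 : (α β : List ℕ) (α-pos : All NonZero α) (β-pos : All NonZero β) (α≢[] : α ≢ []) →
    2 ∣ length α → 2 ∣ length β →
    (a b c : ℤ) → a ≡ ℤ.+ K̆ α → b ≡ ℤ.+ K̆ (α ++ β) → c ≡ ℤ.+ K̆ β →
    Σ̃ ((α , a) , (α ++ β , b) , (β , c)) / 1
    ≡ _/_ (ℤ.+ K̆ (α ++ α)) (K̆ α) {{K̆-nonZero α-pos α≢[]}} * (b / 1) - c / 1
corollary7p19 α β α-pos β-pos α≢[] α-even β-even a b c refl refl refl = begin
  ℤ.+ K̆ (α ++ α ++ β) / 1
    ≡⟨ cong (_/ 1) (pos-minus (K̆ (α ++ α ++ β)) (K̆ β) t (K̆ (α ++ β)) (K̆-recurrence α β α-even)) ⟩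
  (ℤ.+ t ℤ.* b ℤ.- c) / 1
    ≡⟨ /1-*-minus (ℤ.+ t) b c ⟩
  ℤ.+ t / 1 * (b / 1) - c / 1
    -- The trace is expanded by the nonzero `K̆ α`, which makes its numerator the value of
    -- `K̆ (α ++ α)` given by `K̆-square`.
    ≡⟨ cong (λ r → r * (b / 1) - c / 1) (m*n/n≡m/1 t (K̆ α)) ⟨
  ℤ.+ (t ℕ.* K̆ α) / K̆ α * (b / 1) - c / 1
    ≡⟨ cong (λ n → ℤ.+ n / K̆ α * (b / 1) - c / 1) (K̆-square α α-even) ⟨
  ℤ.+ K̆ (α ++ α) / K̆ α * (b / 1) - c / 1 ∎
  where
  open ≡-Reasoning
  t = trace (reverse α)
  instance
    K̆α-nonZero : NonZero (K̆ α)
    K̆α-nonZero = K̆-nonZero α-pos α≢[]
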